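{- For integers $n\ge2$ and $0\le t\le n-2$, the number of $(102,001)$-avoiding inversion sequences $e$ of length $n$ with $\mathrm{rank}(e)=t$ is $2^{n-t-2}$.
   Context: An inversion sequence of length $n$ is an integer sequence $e=(e_1,\dots,e_n)$ with $0\le e_j\le j-1$ for all $j$. It contains a pattern $w=w_1w_2w_3$ if there are indices $i_1<i_2<i_3$ such that $e_{i_1}e_{i_2}e_{i_3}$ is order-isomorphic to $w$ (same relations $<,=,>$ between corresponding pairs of entries); otherwise it avoids $w$. "$(w,w')$-avoiding" means avoiding both $w$ and $w'$. $\max(e)$ is the largest entry, and $\mathrm{fdes}(e)$ is the position $p$ of the first descent: $e_1\le\cdots\le e_p>e_{p+1}$, with the convention $e_{n+1}=-1$. For a $102$-avoiding $e$, $\mathrm{rank}(e):=\mathrm{fdes}(e)-\max(e)-1$. -}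

module Defs where

open import Data.Bool using (if_then_else_)
open import Data.Fin as Fin using (Fin; toℕ)
open import Data.Integer as ℤ using (ℤ; +_; 1ℤ)
open import Data.List using (length)
open import Data.List.Membership.Propositional using (_∈_)
open import Data.List.Relation.Unary.Unique.Propositional using (Unique)
open import Data.Nat using (ℕ; suc; _≤_; _<_; _⊔_; _<?_)
open import Data.Product using (_×_; ∃-syntax)
open import Data.Vec using (Vec; []; _∷_; lookup; foldr′)
open import Function using (_⇔_)
open import Relation.Binary.PropositionalEquality using (_≡_)
open import Relation.Nullary using (¬_; does)

-- The entry e_j (1 ≤ j ≤ n) is `lookup e i` with toℕ i = j - 1, so the bound
-- e_j ≤ j - 1 reads as follows.
IsInversionSequence : ∀ {n} → Vec ℕ n → Set
IsInversionSequence {n} e = ∀ (i : Fin n) → lookup e i ≤ toℕ i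

-- The relation > is covered by exchanging a and b.
OrderIsomorphic : ∀ {k} → Vec ℕ k → Vec ℕ k → Set
OrderIsomorphic {k} u v = ∀ (a b : Fin k) →
  (lookup u a < lookup u b ⇔ lookup v a < lookup v b) ×
  (lookup u a ≡ lookup u b ⇔ lookup v a ≡ lookup v b)

Contains : ∀ {n} → Vec ℕ n → Vec ℕ 3 → Set
Contains {n} e w = ∃[ i₁ ] ∃[ i₂ ] ∃[ i₃ ]
  i₁ Fin.< i₂ × i₂ Fin.< i₃ ×
  OrderIsomorphic (lookup e i₁ ∷ lookup e i₂ ∷ lookup e i₃ ∷ []) w

Avoids : ∀ {n} → Vec ℕ n → Vec ℕ 3 → Set
Avoids e w = ¬ Contains e w

pattern102 pattern001 : Vec ℕ 3
pattern102 = 1 ∷ 0 ∷ 2 ∷ []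
pattern001 = 0 ∷ 0 ∷ 1 ∷ []

-- The value 0 on the empty sequence is junk; on a nonempty sequence of
-- naturals the base 0 does not affect the maximum.
max : ∀ {n} → Vec ℕ n → ℕ
max = foldr′ _⊔_ 0

-- The 1-based position of the first descent. The convention e_{n+1} = -1 makes
-- the last position of a nonempty sequence always a descent, which is the
-- one-entry clause; the value on the empty sequence is junk.
fdes : ∀ {n} → Vec ℕ n → ℕ
fdes []       = 0
fdes (x ∷ []) = 1
fdes (x ∷ y ∷ e) = if does (y <? x) then 1 else suc (fdes (y ∷ e))

-- Integer-valued, so that neither subtraction is truncated.
rank : ∀ {n} → Vec ℕ n → ℤ
rank e = + fdes e ℤ.- + max e ℤ.- 1ℤ

-- Exactly k elements of A satisfy P: they are listed, without repetition, by
-- a list of length k.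
HasCount : {A : Set} → (A → Set) → ℕ → Set
HasCount {A} P k = ∃[ xs ]
  Unique xs × (∀ (x : A) → x ∈ xs ⇔ P x) × length xs ≡ k

{-# OPTIONS --safe #-}
-- Raising every entry by one and prefixing 0, and appending 0, both keep the
-- class of avoiding sequences of rank t, as long as the maximum is positive in
-- the second case. Conversely, if the last entry of such a sequence is
-- positive then so are all entries but the first, since 0, 0 and the last entry
-- would form 001. Hence each sequence of length greater than t + 2 arises in
-- exactly one of the two ways, and the count doubles with the length, starting
-- from the single sequence 0, 1, …, 1 of length t + 2.
module Submission where

open import Defs
open import Data.Bool using (if_then_else_; true; false)
open import Data.Empty using (⊥-elim)
open import Data.Fin as Fin using (Fin; zero; suc; toℕ; fromℕ; inject₁)
open import Data.Fin.Properties using (toℕ-fromℕ; toℕ-inject₁; toℕ<n)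
open import Data.Fin.Relation.Unary.Top using (view; ‵fromℕ; ‵inject₁)
open import Data.Integer as ℤ using (+_; 1ℤ)
import Data.Integer.Properties as ℤ
open import Data.List as List using ([]; _∷_; _++_)
open import Data.List.Membership.Propositional using (_∈_)
open import Data.List.Membership.Propositional.Properties
  using (∈-map⁺; ∈-map⁻; ∈-++⁺ˡ; ∈-++⁺ʳ; ∈-++⁻)
open import Data.List.Properties using (length-++; length-map)
open import Data.List.Relation.Unary.All using ([])
open import Data.List.Relation.Unary.AllPairs using ([]; _∷_)
open import Data.List.Relation.Unary.Any using (here; there)
import Data.List.Relation.Unary.Unique.Propositional.Properties as Unique
open import Data.Nat
  using (ℕ; zero; suc; pred; _+_; _≤_; _<_; _∸_; _^_; _⊔_; _<?_; z≤n; s≤s; z<s; s<s; s<s⁻¹;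
    >-nonZero)
open import Data.Nat.Properties
open import Data.Product using (_×_; _,_; proj₁; proj₂; ∃-syntax)
open import Data.Sum using (_⊎_; inj₁; inj₂)
open import Data.Vec using (Vec; []; _∷_; _∷ʳ_; lookup; map; replicate; initLast)
open import Data.Vec.Properties
  using (lookup-map; lookup-replicate; map-∷ʳ; ∷ʳ-injectiveˡ; ∷-injectiveˡ; ∷-injectiveʳ)
open import Function using (_∘_; _⇔_; mk⇔; Equivalence)
import Function.Properties.Equivalence as ⇔
open import Relation.Binary using (tri<; tri≈; tri>; _Preserves_⟶_)
open import Relation.Binary.PropositionalEquality
  using (_≡_; _≢_; refl; sym; trans; cong; cong₂; subst; module ≡-Reasoning)
open import Relation.Nullary using (¬_; does)

open Equivalence using (to; from)

private
  variable
    k m n t : ℕ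

-- Counting by explicit lists.

HasCount-singleton : {A : Set} {P : A → Set} (a : A) → (∀ x → P x ⇔ x ≡ a) → HasCount P 1
HasCount-singleton a P⇔ =
  a ∷ [] , [] ∷ [] ,
  (λ x → mk⇔ (λ { (here x≡a) → from (P⇔ x) x≡a ; (there ()) }) (here ∘ to (P⇔ x))) , refl

-- The list for `R` is the concatenation of the two mapped lists. Injectivity keeps each half free
-- of repetitions, and `f≢g` keeps the halves disjoint.
HasCount-⊎ : {A B C : Set} {P : A → Set} {Q : B → Set} {R : C → Set} {f : A → C} {g : B → C} →
  (∀ {x y} → f x ≡ f y → x ≡ y) → (∀ {x y} → g x ≡ g y → x ≡ y) → (∀ x y → f x ≢ g y) →
  (∀ z → R z ⇔ ((∃[ x ] P x × z ≡ f x) ⊎ (∃[ y ] Q y × z ≡ g y))) →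
  HasCount P m → HasCount Q n → HasCount R (m + n)
HasCount-⊎ {R = R} {f} {g} f-inj g-inj f≢g R⇔ (xs , xs! , ∈xs⇔ , refl) (ys , ys! , ∈ys⇔ , refl) =
  List.map f xs ++ List.map g ys ,
  Unique.++⁺ (Unique.map⁺ f-inj xs!) (Unique.map⁺ g-inj ys!) disjoint ,
  (λ z → mk⇔ (sound z) (complete z)) ,
  trans (length-++ (List.map f xs)) (cong₂ _+_ (length-map f xs) (length-map g ys))
  where
  disjoint : ∀ {z} → ¬ (z ∈ List.map f xs × z ∈ List.map g ys)
  disjoint (z∈f , z∈g) with ∈-map⁻ f z∈f | ∈-map⁻ g z∈g
  ... | x , _ , z≡fx | y , _ , z≡gy = f≢g x y (trans (sym z≡fx) z≡gy)

  sound : ∀ z → z ∈ List.map f xs ++ List.map g ys → R z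
  sound z z∈ with ∈-++⁻ (List.map f xs) z∈
  ... | inj₁ z∈f = let x , x∈ , eq = ∈-map⁻ f z∈f in from (R⇔ z) (inj₁ (x , to (∈xs⇔ x) x∈ , eq))
  ... | inj₂ z∈g = let y , y∈ , eq = ∈-map⁻ g z∈g in from (R⇔ z) (inj₂ (y , to (∈ys⇔ y) y∈ , eq))

  complete : ∀ z → R z → z ∈ List.map f xs ++ List.map g ys
  complete z Rz with to (R⇔ z) Rz
  ... | inj₁ (x , Px , refl) = ∈-++⁺ˡ (∈-map⁺ f (from (∈xs⇔ x) Px))
  ... | inj₂ (y , Qy , refl) = ∈-++⁺ʳ (List.map f xs) (∈-map⁺ g (from (∈ys⇔ y) Qy))

-- Indexing and mapping of vectors.

lookup-∷ʳ-inject₁ : ∀ {A : Set} (xs : Vec A n) x i → lookup (xs ∷ʳ x) (inject₁ i) ≡ lookup xs i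
lookup-∷ʳ-inject₁ (_ ∷ _)  x zero    = refl
lookup-∷ʳ-inject₁ (_ ∷ xs) x (suc i) = lookup-∷ʳ-inject₁ xs x i

lookup-∷ʳ-fromℕ : ∀ {A : Set} (xs : Vec A n) x → lookup (xs ∷ʳ x) (fromℕ n) ≡ x
lookup-∷ʳ-fromℕ []       x = refl
lookup-∷ʳ-fromℕ (_ ∷ xs) x = lookup-∷ʳ-fromℕ xs x

inject₁<fromℕ : (i : Fin n) → inject₁ i Fin.< fromℕ n
inject₁<fromℕ {n} i rewrite toℕ-inject₁ i | toℕ-fromℕ n = toℕ<n i

inject₁-< : {i j : Fin n} → i Fin.< j → inject₁ i Fin.< inject₁ j
inject₁-< {i = i} {j} i<j rewrite toℕ-inject₁ i | toℕ-inject₁ j = i<j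

inject₁-<⁻ : {i j : Fin n} → inject₁ i Fin.< inject₁ j → i Fin.< j
inject₁-<⁻ {i = i} {j} i<j rewrite toℕ-inject₁ i | toℕ-inject₁ j = i<j

fromℕ≮inject₁ : (i : Fin n) → ¬ (fromℕ n Fin.< inject₁ i)
fromℕ≮inject₁ i = <-asym (inject₁<fromℕ i)

map-injective : ∀ {A B : Set} {f : A → B} → (∀ {x y} → f x ≡ f y → x ≡ y) →
  {xs ys : Vec A n} → map f xs ≡ map f ys → xs ≡ ys
map-injective f-inj {[]}     {[]}     _  = refl
map-injective f-inj {_ ∷ _} {_ ∷ _} eq =
  cong₂ _∷_ (f-inj (∷-injectiveˡ eq)) (map-injective f-inj (∷-injectiveʳ eq))

map-suc-pred : (xs : Vec ℕ n) → (∀ i → lookup xs i ≢ 0) → map suc (map pred xs) ≡ xs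
map-suc-pred []           _   = refl
map-suc-pred (zero ∷ xs)  ≢0  = ⊥-elim (≢0 zero refl)
map-suc-pred (suc x ∷ xs) ≢0  = cong (suc x ∷_) (map-suc-pred xs (≢0 ∘ suc))

-- Order isomorphism under strictly monotone maps.

OrderIsomorphic-resp : {u u′ : Vec ℕ k} (v : Vec ℕ k) → u ≡ u′ →
  OrderIsomorphic u v → OrderIsomorphic u′ v
OrderIsomorphic-resp v refl iso = iso

-- By trichotomy it suffices that `f` preserves whichever of the three relations holds: the other
-- two then fail on both sides, so `f` also reflects order and equality.
OrderIsomorphic-map : {f : ℕ → ℕ} → f Preserves _<_ ⟶ _<_ → (u : Vec ℕ k) →
  OrderIsomorphic (map f u) u
OrderIsomorphic-map {f = f} f-mono u a b rewrite lookup-map a f u | lookup-map b f u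
  with <-cmp (lookup u a) (lookup u b)
... | tri< p ≢ _ = mk⇔ (λ _ → p) f-mono ,
                   mk⇔ (⊥-elim ∘ <⇒≢ (f-mono p)) (⊥-elim ∘ ≢)
... | tri≈ ≮ p _ = mk⇔ (⊥-elim ∘ <-irrefl (cong f p)) (⊥-elim ∘ ≮) ,
                   mk⇔ (λ _ → p) (cong f)
... | tri> ≮ ≢ p = mk⇔ (⊥-elim ∘ <-asym (f-mono p)) (⊥-elim ∘ ≮) ,
                   mk⇔ (⊥-elim ∘ <⇒≢ (f-mono p) ∘ sym) (⊥-elim ∘ ≢)

OrderIsomorphic-map-⇔ : {f : ℕ → ℕ} → f Preserves _<_ ⟶ _<_ → (u v : Vec ℕ k) →
  OrderIsomorphic u v ⇔ OrderIsomorphic (map f u) v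
OrderIsomorphic-map-⇔ f-mono u v = mk⇔
  (λ u≈v a b → ⇔.trans (proj₁ (fu≈u a b)) (proj₁ (u≈v a b)) ,
               ⇔.trans (proj₂ (fu≈u a b)) (proj₂ (u≈v a b)))
  (λ fu≈v a b → ⇔.trans (⇔.sym (proj₁ (fu≈u a b))) (proj₁ (fu≈v a b)) ,
                ⇔.trans (⇔.sym (proj₂ (fu≈u a b))) (proj₂ (fu≈v a b)))
  where fu≈u = OrderIsomorphic-map f-mono u

-- The two extensions: disjoint images, entry bounds and patterns.

raise : Vec ℕ n → Vec ℕ (suc n)
raise e = 0 ∷ map suc e

raise-injective : {e e′ : Vec ℕ n} → raise e ≡ raise e′ → e ≡ e′
raise-injective = map-injective suc-injective ∘ ∷-injectiveʳ

map-suc≢∷ʳ0 : (e : Vec ℕ (suc n)) (e′ : Vec ℕ n) → map suc e ≢ e′ ∷ʳ 0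
map-suc≢∷ʳ0 (x ∷ [])     []       ()
map-suc≢∷ʳ0 (x ∷ y ∷ e) (_ ∷ e′) eq = map-suc≢∷ʳ0 (y ∷ e) e′ (∷-injectiveʳ eq)

-- Since `e` is nonempty, `raise e` ends in a successor and not in the prefixed 0. This makes the
-- two ways of extending a sequence exclusive.
raise≢∷ʳ0 : (e e′ : Vec ℕ (suc n)) → raise e ≢ e′ ∷ʳ 0
raise≢∷ʳ0 e (_ ∷ e′) eq = map-suc≢∷ʳ0 e e′ (∷-injectiveʳ eq)

IsInversionSequence-raise : (e : Vec ℕ n) → IsInversionSequence e ⇔ IsInversionSequence (raise e)
IsInversionSequence-raise e = mk⇔
  (λ { inv zero → z≤n ; inv (suc i) → subst (_≤ _) (sym (lookup-map i suc e)) (s≤s (inv i)) })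
  (λ inv i → ≤-pred (subst (_≤ _) (lookup-map i suc e) (inv (suc i))))

IsInversionSequence-∷ʳ0 : (e : Vec ℕ n) →
  IsInversionSequence e ⇔ IsInversionSequence (e ∷ʳ 0)
IsInversionSequence-∷ʳ0 {n} e = mk⇔ ⇒ ⇐
  where
  ⇒ : IsInversionSequence e → IsInversionSequence (e ∷ʳ 0)
  ⇒ inv i with view i
  ... | ‵fromℕ rewrite lookup-∷ʳ-fromℕ e 0 = z≤n
  ... | ‵inject₁ j rewrite lookup-∷ʳ-inject₁ e 0 j | toℕ-inject₁ j = inv j

  ⇐ : IsInversionSequence (e ∷ʳ 0) → IsInversionSequence e
  ⇐ inv j with inv (inject₁ j)
  ... | p rewrite lookup-∷ʳ-inject₁ e 0 j | toℕ-inject₁ j = p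

triple-cong : ∀ {x x′ y y′ z z′ : ℕ} → x ≡ x′ → y ≡ y′ → z ≡ z′ →
  _≡_ {A = Vec ℕ 3} (x ∷ y ∷ z ∷ []) (x′ ∷ y′ ∷ z′ ∷ [])
triple-cong refl refl refl = refl

-- An occurrence using the prefixed 0 has it as first letter, strictly below the positive second
-- one, which `y ≤ x` forbids. Both 102 and 001 begin with such a pair.
Contains-raise : ∀ {x y z} → y ≤ x → (e : Vec ℕ n) →
  Contains e (x ∷ y ∷ z ∷ []) ⇔ Contains (raise e) (x ∷ y ∷ z ∷ [])
Contains-raise {x = x} {y} {z} y≤x e = mk⇔ ⇒ ⇐
  where
  w = x ∷ y ∷ z ∷ []

  at : _ → _ → _ → Vec ℕ 3
  at i j l = lookup e i ∷ lookup e j ∷ lookup e l ∷ []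

  entries : ∀ i j l → map suc (at i j l) ≡
    lookup (map suc e) i ∷ lookup (map suc e) j ∷ lookup (map suc e) l ∷ []
  entries i j l =
    sym (triple-cong (lookup-map i suc e) (lookup-map j suc e) (lookup-map l suc e))

  ⇒ : Contains e w → Contains (raise e) w
  ⇒ (i , j , l , i<j , j<l , iso) =
    suc i , suc j , suc l , s<s i<j , s<s j<l ,
    OrderIsomorphic-resp w (entries i j l)
      (to (OrderIsomorphic-map-⇔ s<s (at i j l) w) iso)

  ⇐ : Contains (raise e) w → Contains e w
  ⇐ (zero , suc j , l , _ , _ , iso) =
    ⊥-elim (<⇒≱ (to (proj₁ (iso zero (suc zero))) 0<eⱼ) y≤x)
    where 0<eⱼ = subst (0 <_) (sym (lookup-map j suc e)) z<s
  ⇐ (suc i , suc j , suc l , i<j , j<l , iso) =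
    i , j , l , s<s⁻¹ i<j , s<s⁻¹ j<l ,
    from (OrderIsomorphic-map-⇔ s<s (at i j l) w)
      (OrderIsomorphic-resp w (sym (entries i j l)) iso)

-- An occurrence using the appended 0 has it as last letter, and `x < z` would put an entry strictly
-- below 0. Both patterns end above their first letter.
Contains-∷ʳ0 : ∀ {x y z} → x < z → (e : Vec ℕ n) →
  Contains e (x ∷ y ∷ z ∷ []) ⇔ Contains (e ∷ʳ 0) (x ∷ y ∷ z ∷ [])
Contains-∷ʳ0 {x = x} {y} {z} x<z e = mk⇔ ⇒ ⇐
  where
  w = x ∷ y ∷ z ∷ []

  entries : ∀ i j l → lookup e i ∷ lookup e j ∷ lookup e l ∷ [] ≡
    lookup (e ∷ʳ 0) (inject₁ i) ∷ lookup (e ∷ʳ 0) (inject₁ j) ∷ lookup (e ∷ʳ 0) (inject₁ l) ∷ []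
  entries i j l = sym (triple-cong
    (lookup-∷ʳ-inject₁ e 0 i) (lookup-∷ʳ-inject₁ e 0 j) (lookup-∷ʳ-inject₁ e 0 l))

  ⇒ : Contains e w → Contains (e ∷ʳ 0) w
  ⇒ (i , j , l , i<j , j<l , iso) =
    inject₁ i , inject₁ j , inject₁ l , inject₁-< i<j , inject₁-< j<l ,
    OrderIsomorphic-resp w (entries i j l) iso

  ⇐ : Contains (e ∷ʳ 0) w → Contains e w
  ⇐ (i , j , l , i<j , j<l , iso) with view i | view j | view l
  ... | _ | _ | ‵fromℕ =
    ⊥-elim (n≮0 (subst (lookup (e ∷ʳ 0) i <_) (lookup-∷ʳ-fromℕ e 0)
      (from (proj₁ (iso zero (suc (suc zero)))) x<z)))
  -- Once the last index is an old one, the two smaller indices must be old as well.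
  ... | _ | ‵fromℕ | ‵inject₁ l′ = ⊥-elim (fromℕ≮inject₁ l′ j<l)
  ... | ‵fromℕ | ‵inject₁ j′ | ‵inject₁ _ = ⊥-elim (fromℕ≮inject₁ j′ i<j)
  ... | ‵inject₁ i′ | ‵inject₁ j′ | ‵inject₁ l′ =
    i′ , j′ , l′ , inject₁-<⁻ i<j , inject₁-<⁻ j<l ,
    OrderIsomorphic-resp w (sym (entries i′ j′ l′)) iso

contains-001 : (e : Vec ℕ n) {i j l : Fin n} → i Fin.< j → j Fin.< l →
  lookup e i ≡ 0 → lookup e j ≡ 0 → 0 < lookup e l → Contains e pattern001
contains-001 e {i} {j} {l} i<j j<l eᵢ≡0 eⱼ≡0 0<eₗ =
  i , j , l , i<j , j<l ,
  -- The three entries are 0, 0, 1 multiplied by the positive `lookup e l`, and this multiplication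
  -- is strictly monotone.
  OrderIsomorphic-resp pattern001 (triple-cong (sym eᵢ≡0) (sym eⱼ≡0) (*-identityˡ (lookup e l)))
    (OrderIsomorphic-map (*-monoˡ-< (lookup e l) ⦃ >-nonZero 0<eₗ ⦄) pattern001)

-- Maximum and first descent of the extended sequences.

max-map-suc : (e : Vec ℕ (suc n)) → max (map suc e) ≡ suc (max e)
max-map-suc (x ∷ [])    = cong suc (sym (⊔-identityʳ x))
max-map-suc (x ∷ y ∷ e) = cong (suc x ⊔_) (max-map-suc (y ∷ e))

max-∷ʳ0 : (e : Vec ℕ n) → max (e ∷ʳ 0) ≡ max e
max-∷ʳ0 []      = refl
max-∷ʳ0 (x ∷ e) = cong (x ⊔_) (max-∷ʳ0 e)

max≡0⇒replicate : (e : Vec ℕ n) → max e ≡ 0 → e ≡ replicate n 0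
max≡0⇒replicate []         _  = refl
max≡0⇒replicate (zero ∷ e) eq = cong (0 ∷_) (max≡0⇒replicate e eq)
-- `suc x ⊔ max e` computes only after `max e` is split; it is a successor in both cases.
max≡0⇒replicate (suc x ∷ e) eq with max e
max≡0⇒replicate (suc x ∷ e) () | zero
max≡0⇒replicate (suc x ∷ e) () | suc _

max-replicate-0 : ∀ n → max (replicate n 0) ≡ 0
max-replicate-0 zero    = refl
max-replicate-0 (suc n) = max-replicate-0 n

fdes-map-suc : (e : Vec ℕ n) → fdes (map suc e) ≡ fdes e
fdes-map-suc []          = refl
fdes-map-suc (x ∷ [])    = refl
fdes-map-suc (x ∷ y ∷ e) =
  cong (if does (y <? x) then 1 else_) (cong suc (fdes-map-suc (y ∷ e)))

fdes-raise : (e : Vec ℕ (suc n)) → fdes (raise e) ≡ suc (fdes e)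
fdes-raise (x ∷ e) = cong suc (fdes-map-suc (x ∷ e))

-- If `e` has a descent between two of its entries, the appended 0 comes too late to matter.
-- Otherwise `e` increases weakly to a positive last entry, and the 0 creates a true descent exactly
-- where the convention had placed one. An all-zero `e` would instead have its run prolonged.
fdes-∷ʳ0 : (e : Vec ℕ n) → 0 < max e → fdes (e ∷ʳ 0) ≡ fdes e
fdes-∷ʳ0 (suc x ∷ [])       _     = refl
fdes-∷ʳ0 (zero ∷ zero ∷ e)  0<max = cong suc (fdes-∷ʳ0 (zero ∷ e) 0<max)
fdes-∷ʳ0 (suc x ∷ zero ∷ e) _     = refl
fdes-∷ʳ0 (x ∷ suc y ∷ e)    _     =
  cong (if does (suc y <? x) then 1 else_)
    (cong suc (fdes-∷ʳ0 (suc y ∷ e) (<-≤-trans z<s (m≤m⊔n (suc y) (max e)))))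

fdes-replicate-0 : ∀ n → fdes (replicate n 0) ≡ n
fdes-replicate-0 zero          = refl
fdes-replicate-0 (suc zero)    = refl
fdes-replicate-0 (suc (suc n)) = cong suc (fdes-replicate-0 (suc n))

fdes≤length : (e : Vec ℕ n) → fdes e ≤ n
fdes≤length []       = z≤n
fdes≤length (x ∷ []) = ≤-refl
fdes≤length (x ∷ y ∷ e) = step (does (y <? x)) (fdes≤length (y ∷ e))
  where
  step : ∀ b {k n} → k ≤ n → (if b then 1 else suc k) ≤ suc n
  step true  _   = s≤s z≤n
  step false k≤n = s≤s k≤n

-- Rank, and the bounds it gives on the maximum.

rank≡⇔ : (e : Vec ℕ n) → rank e ≡ + t ⇔ fdes e ≡ suc (max e + t)
rank≡⇔ {t = t} e = mk⇔ (ℤ.+-injective ∘ ⇒)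
  (λ eq → trans (cong (λ f → + f ℤ.- + max e ℤ.- 1ℤ) eq) cancel)
  where
  open ≡-Reasoning
  -- `1ℤ ℤ.+ (m ℤ.+ s)` in the identities below computes to `+ suc (max e + t)` at `m = + max e` and
  -- `s = + t`, which links them to the equation in `ℕ`.
  open import Data.Integer.Tactic.RingSolver using (solve-∀)

  regroup : ∀ f m → f ≡ 1ℤ ℤ.+ (m ℤ.+ (f ℤ.- m ℤ.- 1ℤ))
  regroup = solve-∀

  cancel′ : ∀ m s → (1ℤ ℤ.+ (m ℤ.+ s)) ℤ.- m ℤ.- 1ℤ ≡ s
  cancel′ = solve-∀

  cancel : + suc (max e + t) ℤ.- + max e ℤ.- 1ℤ ≡ + t
  cancel = cancel′ (+ max e) (+ t)

  ⇒ : rank e ≡ + t → + fdes e ≡ + suc (max e + t)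
  ⇒ eq = trans (regroup (+ fdes e) (+ max e)) (cong (λ r → 1ℤ ℤ.+ (+ max e ℤ.+ r)) eq)

-- First descent and maximum both grow by one, so their difference is unchanged.
rank-raise : (e : Vec ℕ (suc n)) → rank (raise e) ≡ rank e
rank-raise e rewrite fdes-raise e | max-map-suc e = cong (ℤ._- 1ℤ) (begin
  + suc (fdes e) ℤ.- + suc (max e)  ≡⟨ ℤ.[1+m]⊖[1+n]≡m⊖n (fdes e) (max e) ⟩
  fdes e ℤ.⊖ max e                  ≡⟨ ℤ.m-n≡m⊖n (fdes e) (max e) ⟨
  + fdes e ℤ.- + max e              ∎)
  where open ≡-Reasoning

rank-∷ʳ0 : (e : Vec ℕ n) → 0 < max e → rank (e ∷ʳ 0) ≡ rank e
rank-∷ʳ0 e 0<max rewrite fdes-∷ʳ0 e 0<max | max-∷ʳ0 e = refl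

rank-replicate-0 : ∀ t → rank (replicate (suc t) 0) ≡ + t
rank-replicate-0 t = from (rank≡⇔ (replicate (suc t) 0))
  (trans (fdes-replicate-0 (suc t)) (cong (λ m → suc (m + t)) (sym (max-replicate-0 t))))

max+rank<length : (e : Vec ℕ n) → rank e ≡ + t → max e + t < n
max+rank<length e r = subst (_≤ _) (to (rank≡⇔ e) r) (fdes≤length e)

-- Maximum 0 would make `e` all zero, with its first descent at the end and hence rank one less than
-- `n`, contrary to `suc t < n`.
0<max : (e : Vec ℕ n) → suc t < n → rank e ≡ + t → 0 < max e
0<max {n} e t+1<n r = n≢0⇒n>0 λ max≡0 → <-irrefl (begin
  suc _                 ≡⟨ cong (λ m → suc (m + _)) max≡0 ⟨
  suc (max e + _)       ≡⟨ to (rank≡⇔ e) r ⟨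
  fdes e                ≡⟨ cong fdes (max≡0⇒replicate e max≡0) ⟩
  fdes (replicate n 0)  ≡⟨ fdes-replicate-0 n ⟩
  n                     ∎) t+1<n
  where open ≡-Reasoning

-- The class to be counted and its decomposition.

AvoidingOfRank : ℕ → Vec ℕ n → Set
AvoidingOfRank t e =
  IsInversionSequence e × Avoids e pattern102 × Avoids e pattern001 × rank e ≡ + t

AvoidingOfRank-raise : (e : Vec ℕ (suc n)) → AvoidingOfRank t e ⇔ AvoidingOfRank t (raise e)
AvoidingOfRank-raise e = mk⇔
  (λ (inv , a , b , r) →
    to (IsInversionSequence-raise e) inv , a ∘ from (Contains-raise z≤n e) ,
    b ∘ from (Contains-raise z≤n e) , trans (rank-raise e) r)
  (λ (inv , a , b , r) →
    from (IsInversionSequence-raise e) inv , a ∘ to (Contains-raise z≤n e) ,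
    b ∘ to (Contains-raise z≤n e) , trans (sym (rank-raise e)) r)

AvoidingOfRank-∷ʳ0 : (e : Vec ℕ n) → 0 < max e → AvoidingOfRank t e ⇔ AvoidingOfRank t (e ∷ʳ 0)
AvoidingOfRank-∷ʳ0 e 0<m = mk⇔
  (λ (inv , a , b , r) →
    to (IsInversionSequence-∷ʳ0 e) inv , a ∘ from (Contains-∷ʳ0 (s<s z<s) e) ,
    b ∘ from (Contains-∷ʳ0 z<s e) , trans (rank-∷ʳ0 e 0<m) r)
  (λ (inv , a , b , r) →
    from (IsInversionSequence-∷ʳ0 e) inv , a ∘ to (Contains-∷ʳ0 (s<s z<s) e) ,
    b ∘ to (Contains-∷ʳ0 z<s e) , trans (sym (rank-∷ʳ0 e 0<m)) r)

AvoidingOfRank-replicate-0 : ∀ t → AvoidingOfRank t (replicate (suc t) 0)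
AvoidingOfRank-replicate-0 t =
  (λ i → subst (_≤ toℕ i) (sym (lookup-replicate i 0)) z≤n) ,
  -- Each pattern has two unequal letters, here 0 and 1, which a constant sequence cannot match.
  (λ (i , j , _ , _ , _ , iso) → constant j i (from (proj₁ (iso (suc zero) zero)) z<s)) ,
  (λ (i , _ , l , _ , _ , iso) → constant i l (from (proj₁ (iso zero (suc (suc zero)))) z<s)) ,
  rank-replicate-0 t
  where
  constant : ∀ i j → ¬ (lookup (replicate (suc t) 0) i < lookup (replicate (suc t) 0) j)
  constant i j lt = n≮0 (subst (lookup (replicate (suc t) 0) i <_) (lookup-replicate j 0) lt)

ends-in-0-or-raised : (e : Vec ℕ (suc (suc n))) → IsInversionSequence e → Avoids e pattern001 →
  (∃[ d ] e ≡ raise d) ⊎ (∃[ d ] e ≡ d ∷ʳ 0)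
ends-in-0-or-raised e inv avoids with initLast e
... | d , zero , eq = inj₂ (d , eq)
-- The inversion bound forces the first entry to be 0.
... | suc _ ∷ _ , suc _ , refl = ⊥-elim (n≮0 (inv zero))
-- Every entry after the first is positive, so lowering each by one gives the preimage under
-- `raise`.
... | zero ∷ zs , suc y , refl = inj₁ (map pred zs ∷ʳ y , cong (0 ∷_) (begin
  zs ∷ʳ suc y                     ≡⟨ cong (_∷ʳ suc y) (map-suc-pred zs zs≢0) ⟨
  map suc (map pred zs) ∷ʳ suc y  ≡⟨ map-∷ʳ suc y (map pred zs) ⟨
  map suc (map pred zs ∷ʳ y)      ∎))
  where
  open ≡-Reasoning
  zs≢0 : ∀ i → lookup zs i ≢ 0
  zs≢0 i zsᵢ≡0 = avoids (contains-001 (0 ∷ (zs ∷ʳ suc y))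
    z<s (s<s (inject₁<fromℕ i)) refl (trans (lookup-∷ʳ-inject₁ zs (suc y) i) zsᵢ≡0)
    (subst (0 <_) (sym (lookup-∷ʳ-fromℕ zs (suc y))) z<s))

-- Removing a final 0 leaves the maximum unchanged, so `d` inherits its positivity. That is what
-- lets the rank survive the removal, and it is kept in the result to exclude this case at the
-- shortest length.
AvoidingOfRank-split : (e : Vec ℕ (suc (suc n))) → 0 < max e → AvoidingOfRank t e →
  (∃[ d ] AvoidingOfRank t d × e ≡ raise d) ⊎
  (∃[ d ] (0 < max d × AvoidingOfRank t d) × e ≡ d ∷ʳ 0)
AvoidingOfRank-split e 0<m A@(inv , _ , avoids , _) with ends-in-0-or-raised e inv avoids
... | inj₁ (d , refl) = inj₁ (d , from (AvoidingOfRank-raise d) A , refl)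
... | inj₂ (d , refl) = inj₂ (d , (0<max-d , from (AvoidingOfRank-∷ʳ0 d 0<max-d) A) , refl)
  where 0<max-d = subst (0 <_) (max-∷ʳ0 d) 0<m

-- The count by induction on the length.

rank-maximal : (e : Vec ℕ (suc t)) → rank e ≡ + t → max e ≡ 0
-- The first descent is at most the length `suc t`, so `max e + t` is at most `t`.
rank-maximal {t} e r = n≤0⇒n≡0 (+-cancelʳ-≤ t (max e) 0 (≤-pred (max+rank<length e r)))

count-shortest : ∀ t → HasCount (AvoidingOfRank {2 + t} t) 1
count-shortest t = HasCount-singleton (raise (replicate (suc t) 0)) λ e → mk⇔ (unique e)
  (λ { refl → to (AvoidingOfRank-raise (replicate (suc t) 0)) (AvoidingOfRank-replicate-0 t) })
  where
  unique : ∀ e → AvoidingOfRank t e → e ≡ raise (replicate (suc t) 0)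
  -- Either way `d` has length `suc t` and rank `t`, hence maximum 0. A raised `d` is therefore all
  -- zero, and an appended 0 contradicts `0 < max d`.
  unique e A@(_ , _ , _ , r) with AvoidingOfRank-split e (0<max e ≤-refl r) A
  ... | inj₁ (d , (_ , _ , _ , r′) , refl) =
    cong raise (max≡0⇒replicate d (rank-maximal d r′))
  ... | inj₂ (d , (0<m , (_ , _ , _ , r′)) , _) = ⊥-elim (<⇒≢ 0<m (sym (rank-maximal d r′)))

count : ∀ k t → HasCount (AvoidingOfRank {2 + (k + t)} t) (2 ^ k)
count zero    t = count-shortest t
count (suc k) t =
  -- `2 ^ suc k` computes to `2 ^ k + (2 ^ k + 0)`.
  subst (HasCount _) (cong (λ c → 2 ^ k + c) (sym (+-identityʳ (2 ^ k))))
    (HasCount-⊎ raise-injective (∷ʳ-injectiveˡ _ _) raise≢∷ʳ0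
      (λ e → mk⇔ (split e) (merge e)) (count k t) (count k t))
  where
  long : ∀ j → suc t < 2 + (j + t)
  long j = s<s (s≤s (m≤n+m t j))

  split : ∀ e → AvoidingOfRank t e →
    (∃[ d ] AvoidingOfRank t d × e ≡ raise d) ⊎ (∃[ d ] AvoidingOfRank t d × e ≡ d ∷ʳ 0)
  split e A@(_ , _ , _ , r) with AvoidingOfRank-split e (0<max e (long (suc k)) r) A
  ... | inj₁ raised             = inj₁ raised
  ... | inj₂ (d , (_ , A′) , eq) = inj₂ (d , A′ , eq)

  merge : ∀ e →
    (∃[ d ] AvoidingOfRank t d × e ≡ raise d) ⊎ (∃[ d ] AvoidingOfRank t d × e ≡ d ∷ʳ 0) →
    AvoidingOfRank t e
  merge _ (inj₁ (d , A , refl)) = to (AvoidingOfRank-raise d) A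
  merge _ (inj₂ (d , A@(_ , _ , _ , r) , refl)) =
    to (AvoidingOfRank-∷ʳ0 d (0<max d (long k) r)) A

proposition5p2 : ∀ (n t : ℕ) → 2 ≤ n → t ≤ n ∸ 2 →
    HasCount
    (λ (e : Vec ℕ n) →
    IsInversionSequence e × Avoids e pattern102 × Avoids e pattern001 × rank e ≡ + t)
    (2 ^ (n ∸ t ∸ 2))
proposition5p2 n t 2≤n t≤n∸2 =
  -- `count` is applied with `k = n ∸ t ∸ 2`; the hypotheses make the truncated subtractions exact,
  -- so its length is `n`.
  subst (λ l → HasCount (AvoidingOfRank {l} t) (2 ^ (n ∸ t ∸ 2))) length≡ (count (n ∸ t ∸ 2) t)
  where
  open ≡-Reasoning
  length≡ : 2 + (n ∸ t ∸ 2 + t) ≡ n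
  length≡ = begin
    2 + (n ∸ t ∸ 2 + t)     ≡⟨ cong (λ l → 2 + (l + t)) (∸-+-assoc n t 2) ⟩
    2 + (n ∸ (t + 2) + t)   ≡⟨ cong (λ l → 2 + (n ∸ l + t)) (+-comm t 2) ⟩
    2 + (n ∸ (2 + t) + t)   ≡⟨ cong (λ l → 2 + (l + t)) (∸-+-assoc n 2 t) ⟨
    2 + (n ∸ 2 ∸ t + t)     ≡⟨ cong (λ l → 2 + l) (m∸n+n≡m t≤n∸2) ⟩
    2 + (n ∸ 2)             ≡⟨ m+[n∸m]≡n 2≤n ⟩
    n                       ∎
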